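{- For every integer $n\ge 1$, the number of domino tilings of the Aztec diamond $AD(n)$ that are invariant under the reflection $t$ equals \[\|C_n\|_{l^1}=\sum_{(\epsilon_1,\ldots,\epsilon_{2n})\in\{0,1\}^{2n}} C_n(\epsilon_1,\ldots,\epsilon_{2n}).\]
   Context: The Aztec diamond $AD(n)$ is the union of all unit lattice squares $[i,i+1]\times[j,j+1]$ ($i,j\in\mathbb{Z}$) contained in the region $|x|+|y|\le n+1$. A domino tiling is a covering of $AD(n)$ by $1\times 2$ or $2\times1$ dominoes without gaps or overlaps. Let $t$ be the reflection across the line $x=0$ (the vertical diagonal of the diamond); a tiling is $t$-invariant if $t$ maps it to itself. For $m\ge1$, $\{0,1\}^m$ is the set of binary sequences of length $m$ and $\mathbb{Z}\langle\{0,1\}^m\rangle$ the free abelian group with basis $\{0,1\}^m$. Maps defined on basis elements are extended $\mathbb{Z}$-linearly, and a function $\{0,1\}^m\to\mathbb{Z}_{\ge0}$ is extended to the unique homomorphism $\mathbb{Z}\langle\{0,1\}^m\rangle\to\mathbb{Z}$ (sending $0$ to $0$). (i) $R_m(\epsilon_1,\ldots,\epsilon_m)=(1-\epsilon_1,\ldots,1-\epsilon_m)$. (ii) For $m\ge2$ and $1\le i\le m-1$, $E_m^i$ is the endomorphism of $\mathbb{Z}\langle\{0,1\}^m\rangle$ with $E_m^i(\epsilon)=\epsilon+\epsilon'$ if $(\epsilon_i,\epsilon_{i+1})=(0,0)$, where $\epsilon'$ is $\epsilon$ with entries $i,i+1$ replaced by $1,1$, and $E_m^i(\epsilon)=\epsilon$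 otherwise. Set $E_m=E_m^{m-1}\circ\cdots\circ E_m^{1}$. (iii) For $m\ge4$, $K_m:\mathbb{Z}\langle\{0,1\}^m\rangle\to\mathbb{Z}\langle\{0,1\}^{m-2}\rangle$ is given on basis elements $\epsilon=(\epsilon_1,\ldots,\epsilon_m)$ by: $K_m(\epsilon)=0$ if $(\epsilon_1,\epsilon_2)=(0,1)$ or $(\epsilon_{m-1},\epsilon_m)=(1,0)$; otherwise $K_m(\epsilon)=(a,\epsilon_3,\ldots,\epsilon_{m-2},b)$ where $a=0$ if $(\epsilon_1,\epsilon_2)=(1,0)$ and $a=1$ if $(\epsilon_1,\epsilon_2)\in\{(0,0),(1,1)\}$, and $b=0$ if $(\epsilon_{m-1},\epsilon_m)=(0,1)$ and $b=1$ if $(\epsilon_{m-1},\epsilon_m)\in\{(0,0),(1,1)\}$. (iv) $C_1:\{0,1\}^2\to\mathbb{Z}_{\ge0}$ is $C_1(0,0)=C_1(1,1)=1$, $C_1(0,1)=C_1(1,0)=0$, and for $n\ge2$, $C_n:\{0,1\}^{2n}\to\mathbb{Z}_{\ge0}$ is $C_n=C_{n-1}\circ R_{2n-2}\circ E_{2n-2}\circ K_{2n}$. -}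

module Defs where

open import Data.Bool using (Bool; true; false; not; _∧_; if_then_else_; T)
open import Data.Nat using (ℕ; zero; suc; _+_; _≤?_; _<?_)
open import Data.Integer as ℤ using (ℤ; ∣_∣) renaming (_+_ to _+ℤ_; _-_ to _-ℤ_)
open import Data.Fin using (Fin; toℕ; fromℕ<; opposite)
open import Data.Maybe using (Maybe; just; nothing) renaming (map to mapMaybe)
open import Data.Vec using (Vec; []; _∷_; lookup)
open import Data.List using (List; []; _∷_; [_]; map; concatMap; foldl; upTo; allFin; _++_)
open import Data.Product using (Σ; _×_; _,_)
open import Relation.Nullary.Decidable using (⌊_⌋; yes; no)
open import Data.Nat.ListAction using (sum)
open import Data.Bool.ListAction using (all)

-- Part 1: the maps R, E, K, C on ℤ⟨{0,1}^m⟩.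
-- A binary sequence (ε₁,…,ε_m) is a Vec Bool m (false = 0, true = 1).
-- An element of the free abelian group with nonnegative coefficients
-- (all maps below send basis elements to such elements) is represented
-- as a finite multiset of basis elements, i.e. a List (Bits m); the
-- ℤ-linear extension of a map f on basis elements is concatMap f.

Bits : ℕ → Set
Bits m = Vec Bool m

R : ∀ {m} → Bits m → Bits m
R = Data.Vec.map not

-- E_m^{k+1} (acting on the positions k+1, k+2; k is 0-based)
Estep : ∀ {m} → ℕ → Bits m → List (Bits m)
Estep zero (false ∷ false ∷ xs) = (false ∷ false ∷ xs) ∷ (true ∷ true ∷ xs) ∷ []
Estep zero xs = [ xs ]
Estep (suc k) [] = [ [] ]
Estep (suc k) (x ∷ xs) = map (x ∷_) (Estep k xs)

E : ∀ {m} → Bits m → List (Bits m)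
E {m} ε = foldl (λ acc k → concatMap (Estep k) acc) [ ε ] (upTo (m Data.Nat.∸ 1))

lastTwo : ∀ {k} → Vec Bool (suc (suc k)) → Vec Bool k × Bool × Bool
lastTwo {zero} (x ∷ y ∷ []) = [] , x , y
lastTwo {suc k} (x ∷ xs) with lastTwo {k} xs
... | mid , y , z = (x ∷ mid) , y , z

K : ∀ {k} → Bits (suc (suc (suc (suc k)))) → List (Bits (suc (suc k)))
K (e1 ∷ e2 ∷ rest) with lastTwo rest
... | mid , e3 , e4 = front e1 e2
  where
  back : Bool → Bool → Bool → List (Bits (suc (suc _)))
  back a false false = [ (a ∷ Data.Vec._∷ʳ_ mid true) ]
  back a true true = [ (a ∷ Data.Vec._∷ʳ_ mid true) ]
  back a false true = [ (a ∷ Data.Vec._∷ʳ_ mid false) ]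
  back a true false = []
  front : Bool → Bool → List (Bits (suc (suc _)))
  front false true = []
  front true false = back false e3 e4
  front false false = back true e3 e4
  front true true = back true e3 e4

-- doubling, with dbl n = 2n definitionally in the needed shape
dbl : ℕ → ℕ
dbl zero = zero
dbl (suc n) = suc (suc (dbl n))

Cs : (k : ℕ) → Bits (dbl (suc k)) → ℕ
Cs zero (a ∷ b ∷ []) = if ⌊ a Data.Bool.≟ b ⌋ then 1 else 0
Cs (suc k) ε = sum (map (Cs k) (concatMap (λ x → map R (E x)) (K ε)))

-- C_n for n ≥ 1 (value at n = 0 is irrelevant)
C : (n : ℕ) → Bits (dbl n) → ℕ
C zero _ = 0
C (suc k) = Cs k

allBits : (m : ℕ) → List (Bits m)
allBits zero = [ [] ]
allBits (suc m) = map (false ∷_) (allBits m) ++ map (true ∷_) (allBits m)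

normC : ℕ → ℕ
normC n = sum (map (C n) (allBits (dbl n)))

-- Part 2: domino tilings of AD(n).
-- Unit squares are indexed by their lower-left corner (i,j) ∈ ℤ²; we work in
-- the box i,j ∈ [-(n+1), n] (which contains every square of AD(n)),
-- indexed by a,b : Fin (2(n+1)) with i = a - (n+1), j = b - (n+1).

box : ℕ → ℕ
box n = dbl (suc n)

coord : ∀ {n} → Fin (box n) → ℤ
coord {n} a = ℤ.+ toℕ a -ℤ ℤ.+ suc n

inRegion : ℕ → ℤ → ℤ → Bool
inRegion n x y = ⌊ ∣ x ∣ + ∣ y ∣ ≤? suc n ⌋

-- the square [i,i+1]×[j,j+1] is contained in the region (by convexity,
-- iff its four corners are)
inAD : (n : ℕ) → Fin (box n) → Fin (box n) → Bool
inAD n a b =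
  inRegion n i j ∧ inRegion n (i +ℤ ℤ.+ 1) j ∧
  inRegion n i (j +ℤ ℤ.+ 1) ∧ inRegion n (i +ℤ ℤ.+ 1) (j +ℤ ℤ.+ 1)
  where
  i = coord {n} a
  j = coord {n} b

-- direction from a square to the other square of its domino
data Dir : Set where
  up down left right : Dir

opp : Dir → Dir
opp up = down
opp down = up
opp left = right
opp right = left

eqDir : Dir → Dir → Bool
eqDir up up = true
eqDir down down = true
eqDir left left = true
eqDir right right = true
eqDir _ _ = false

eqMDir : Maybe Dir → Maybe Dir → Bool
eqMDir nothing nothing = true
eqMDir (just d) (just e) = eqDir d e
eqMDir _ _ = false

toFin? : (N : ℕ) → ℕ → Maybe (Fin N)
toFin? N m with m <? N
... | yes p = just (fromℕ< p)
... | no _ = nothing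

inc dec : ∀ {N} → Fin N → Maybe (Fin N)
inc {N} a = toFin? N (suc (toℕ a))
dec {N} a with toℕ a
... | zero = nothing
... | suc p = toFin? N p

step : ∀ {N} → Dir → Fin N → Fin N → Maybe (Fin N × Fin N)
step up a b = mapMaybe (λ b' → a , b') (inc b)
step down a b = mapMaybe (λ b' → a , b') (dec b)
step right a b = mapMaybe (λ a' → a' , b) (inc a)
step left a b = mapMaybe (λ a' → a' , b) (dec a)

-- A tiling is recorded as a grid assigning to every square of AD(n) the
-- direction of its domino partner, and `nothing` to squares outside AD(n).
Grid : ℕ → Set
Grid n = Vec (Vec (Maybe Dir) (box n)) (box n)

at : ∀ {n} → Grid n → Fin (box n) → Fin (box n) → Maybe Dir
at g a b = lookup (lookup g a) b

cellOK : (n : ℕ) → Grid n → Fin (box n) → Fin (box n) → Bool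
cellOK n g a b with at g a b
... | nothing = not (inAD n a b)
... | just d with step d a b
...   | nothing = false
...   | just (a' , b') = inAD n a b ∧ inAD n a' b' ∧ eqMDir (at g a' b') (just (opp d))

isTiling : (n : ℕ) → Grid n → Bool
isTiling n g = all (λ a → all (λ b → cellOK n g a b) (allFin (box n))) (allFin (box n))

-- reflection t across x = 0: square (i,j) ↦ (-i-1,j), i.e. a ↦ opposite a;
-- directions left/right are swapped
reflDir : Dir → Dir
reflDir left = right
reflDir right = left
reflDir up = up
reflDir down = down

isTInvariant : (n : ℕ) → Grid n → Bool
isTInvariant n g =
  all (λ a → all (λ b → eqMDir (at g (opposite a) b) (mapMaybe reflDir (at g a b)))
                 (allFin (box n))) (allFin (box n))

InvTiling : ℕ → Set
InvTiling n = Σ (Grid n) (λ g → T (isTiling n g ∧ isTInvariant n g))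

{-# OPTIONS --safe #-}
-- A t-invariant tiling is determined by its dominoes in the half plane x ≥ 0, where the
-- dominoes crossing the axis cover an arbitrary set of squares of column 0.  Read this half
-- column by column and let ε record the squares of a column that are covered from the left,
-- ρ those covered towards the right; ρ is the ε of the next column.  The squares with
-- ε = ρ = 0 split into maximal runs, each tiled by vertical dominoes in at most one way, so
-- the tiling is the same as its sequence of ε's.  One passage from ε to ρ is what R ∘ E ∘ K
-- enumerates: K settles the top and bottom squares, which have no right neighbour, E
-- places the vertical dominoes, and R turns the squares left over into the ones covered
-- from the left in the next column.
module Submission where

open import Defs
open import Data.Bool using (Bool; true; false; T; not; _∧_)
open import Data.Bool.ListAction using (all)
open import Data.Bool.Properties using (⇔→≡; T-∧; T-irrelevant)
open import Data.Empty using (⊥; ⊥-elim)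
open import Data.Fin using (Fin; toℕ; fromℕ<; opposite)
open import Data.Fin.Properties using (+↔⊎; toℕ<n; toℕ-fromℕ<; fromℕ<-toℕ; toℕ-injective; opposite-prop)
import Data.Integer as ℤ
import Data.Integer.Properties as ℤ
open import Data.List using (List; []; _∷_; [_]; _++_; map; foldl; concatMap; upTo; applyUpTo; allFin)
open import Data.List.Membership.Propositional.Properties using (∈-allFin)
open import Data.List.Properties using (map-upTo; concatMap-map; map-concatMap; map-++; concatMap-++)
import Data.List.Relation.Unary.All as All
open import Data.List.Relation.Unary.All.Properties using (all⁺; all⁻)
open import Data.List.Relation.Unary.Any using (Any; here; there)
open import Data.List.Relation.Unary.Any.Properties using (++↔; map↔; concat↔; ∷↔; Any-cong)
open import Data.Maybe using (Maybe; just; nothing) renaming (map to mapMaybe)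
open import Data.Maybe.Properties using (just-injective)
open import Data.Nat using (ℕ; zero; suc; _+_; _∸_; _≤_; _<_; z≤n; s≤s; s≤s⁻¹; ∣_-_∣; _<?_; _≤?_)
open import Data.Nat.ListAction using (sum)
open import Data.Nat.Properties
open import Data.Product using (Σ; _×_; _,_; proj₁; proj₂)
open import Data.Product.Algebra using (×-cong)
open import Data.Product.Function.Dependent.Propositional using (congˡ)
open import Data.Sum using (_⊎_; inj₁; inj₂)
open import Data.Sum.Function.Propositional using (_⊎-cong_)
open import Data.Unit using (⊤; tt)
open import Data.Vec using (Vec; []; _∷_; _∷ʳ_; lookup; tabulate)
open import Data.Vec.Properties using (∷-injective; lookup∘tabulate; tabulate∘lookup; tabulate-cong)
open import Function using (_∘_; _∋_)
open import Function.Bundles using (_↔_; _⇔_; mk↔ₛ′; mk⇔; Equivalence)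
open import Function.Properties.Inverse using (↔-refl; ↔-sym; ↔-trans)
open import Relation.Binary.PropositionalEquality using (_≡_; _≢_; refl; sym; trans; cong; cong₂; subst; subst₂)
open import Relation.Nullary using (¬_; yes; no)
open import Relation.Nullary.Decidable using (toWitness; fromWitness)

open Equivalence using (to; from)

-- C as a count of chains of columns

-- Counting is done with types: an element of `Any (Fin ∘ f) xs` is a position in the list together
-- with a choice there. Positions keep multiplicities apart, so coefficients in the free abelian
-- group become disjoint unions.
sum↔Any : {A : Set} (f : A → ℕ) (xs : List A) → Fin (sum (map f xs)) ↔ Any (Fin ∘ f) xs
sum↔Any f [] = mk↔ₛ′ (λ ()) (λ ()) (λ ()) (λ ())
sum↔Any f (x ∷ xs) =
  ↔-trans +↔⊎ (↔-trans (↔-refl ⊎-cong sum↔Any f xs) (∷↔ (Fin ∘ f)))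

allBits↔ : ∀ m (P : Bits m → Set) → Any P (allBits m) ↔ Σ (Bits m) P
allBits↔ zero P = mk↔ₛ′ (λ { (here p) → [] , p }) (λ { ([] , p) → here p })
  (λ { ([] , p) → refl }) (λ { (here p) → refl })
allBits↔ (suc m) P =
  ↔-trans (↔-sym ++↔)
    (↔-trans ((↔-trans (↔-sym map↔) (allBits↔ m (P ∘ (false ∷_))))
              ⊎-cong (↔-trans (↔-sym map↔) (allBits↔ m (P ∘ (true ∷_)))))
      split)
  where
  split : (Σ (Bits m) (P ∘ (false ∷_)) ⊎ Σ (Bits m) (P ∘ (true ∷_))) ↔ Σ (Bits (suc m)) P
  split = mk↔ₛ′ (λ { (inj₁ (x , p)) → false ∷ x , p ; (inj₂ (x , p)) → true ∷ x , p })
    (λ { (false ∷ x , p) → inj₁ (x , p) ; (true ∷ x , p) → inj₂ (x , p) })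
    (λ { (false ∷ x , p) → refl ; (true ∷ x , p) → refl })
    (λ { (inj₁ (x , p)) → refl ; (inj₂ (x , p)) → refl })

-- ε marks the cells covered from the left, ρ those whose domino sticks out to the right.
data Col : ∀ {m} → Bits m → Bits m → Set where
  nil   : Col [] []
  left  : ∀ {m} {ε ρ : Bits m} → Col ε ρ → Col (true ∷ ε) (false ∷ ρ)
  right : ∀ {m} {ε ρ : Bits m} → Col ε ρ → Col (false ∷ ε) (true ∷ ρ)
  vert  : ∀ {m} {ε ρ : Bits m} → Col ε ρ → Col (false ∷ false ∷ ε) (false ∷ false ∷ ρ)

-- The leading bits of `ε` and `ρ` determine the constructor. Links between columns are therefore
-- propositions, and implications both ways already give a bijection between them.
Col-irrelevant : ∀ {m} {ε ρ : Bits m} (c d : Col ε ρ) → c ≡ d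
Col-irrelevant nil       nil       = refl
Col-irrelevant (left c)  (left d)  = cong left (Col-irrelevant c d)
Col-irrelevant (right c) (right d) = cong right (Col-irrelevant c d)
Col-irrelevant (vert c)  (vert d)  = cong vert (Col-irrelevant c d)

-- The fold inside `E`, with the positions and the starting multiset left free so that induction on
-- the positions is possible.
Esteps : ∀ {m} → List ℕ → List (Bits m) → List (Bits m)
Esteps ks acc = foldl (λ acc k → concatMap (Estep k) acc) acc ks

Esteps-++ : ∀ {m} ks (xs ys : List (Bits m)) →
            Esteps ks (xs ++ ys) ≡ Esteps ks xs ++ Esteps ks ys
Esteps-++ []       xs ys = refl
Esteps-++ (k ∷ ks) xs ys =
  trans (cong (Esteps ks) (concatMap-++ (Estep k) xs ys)) (Esteps-++ ks _ _)

Esteps-map-suc : ∀ {m} ks x (acc : List (Bits m)) →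
                 Esteps (map suc ks) (map (x ∷_) acc) ≡ map (x ∷_) (Esteps ks acc)
Esteps-map-suc []       x acc = refl
Esteps-map-suc (k ∷ ks) x acc = trans (cong (Esteps (map suc ks)) step-suc) (Esteps-map-suc ks x _)
  where
  step-suc : concatMap (Estep (suc k)) (map (x ∷_) acc) ≡ map (x ∷_) (concatMap (Estep k) acc)
  step-suc = trans (concatMap-map (Estep (suc k)) (x ∷_) acc) (sym (map-concatMap (x ∷_) (Estep k) acc))

-- Once position 0 has been treated, the remaining steps never touch the head, and on the tail they
-- are exactly the steps of `E`.
E-tail : ∀ {m} x (ε : Bits (suc m)) →
         Esteps (applyUpTo suc m) [ x ∷ ε ] ≡ map (x ∷_) (E ε)
E-tail {m} x ε = trans (cong (λ ks → Esteps ks [ x ∷ ε ]) (sym (map-upTo suc m)))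
                       (Esteps-map-suc (upTo m) x [ ε ])

E-true : ∀ {m} (ε : Bits m) → E (true ∷ ε) ≡ map (true ∷_) (E ε)
E-true []      = refl
E-true (x ∷ ε) = E-tail true (x ∷ ε)

E-false-true : ∀ {m} (ε : Bits m) → E (false ∷ true ∷ ε) ≡ map (false ∷_) (E (true ∷ ε))
E-false-true ε = E-tail false (true ∷ ε)

-- The first step branches. If the pair is kept, the head is settled but its neighbour may still be
-- paired with the next cell; if the pair is raised to 1,1, both cells are settled.
E-false-false : ∀ {m} (ε : Bits m) →
  E (false ∷ false ∷ ε) ≡ map (false ∷_) (E (false ∷ ε)) ++ map (true ∷_) (E (true ∷ ε))
E-false-false {m} ε =
  trans (Esteps-++ (applyUpTo suc m) [ false ∷ false ∷ ε ] [ true ∷ true ∷ ε ])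
        (cong₂ _++_ (E-tail false (false ∷ ε)) (E-tail true (true ∷ ε)))

Any-≡ : ∀ {A : Set} {P : A → Set} {xs ys} → xs ≡ ys → Any P xs ↔ Any P ys
Any-≡ refl = ↔-refl

Any-map-R∷ : ∀ {m} x (P : Bits (suc m) → Set) (L : List (Bits m)) →
             Any P (map R (map (x ∷_) L)) ↔ Any (P ∘ (not x ∷_)) (map R L)
Any-map-R∷ x P L = ↔-trans (↔-sym map↔) (↔-trans (↔-sym map↔) map↔)

-- Ones in the output of `E` are cells covered from the left or by a vertical domino; `R` turns the
-- remaining zeros into the cells whose dominoes stick out to the right. A zero that `E` passes over
-- corresponds to `right`, a raised pair to `vert`.
E↔Col : ∀ {m} (ε : Bits m) (P : Bits m → Set) →
        Any P (map R (E ε)) ↔ Σ (Bits m) (λ ρ → Col ε ρ × P ρ)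
E↔Col [] P = mk↔ₛ′ (λ { (here p) → [] , nil , p }) (λ { ([] , nil , p) → here p })
  (λ { ([] , nil , p) → refl }) (λ { (here p) → refl })
E↔Col (true ∷ ε) P =
  ↔-trans (Any-≡ (cong (map R) (E-true ε))) (↔-trans (Any-map-R∷ true P (E ε))
  (↔-trans (E↔Col ε (P ∘ (false ∷_)))
    (mk↔ₛ′ (λ { (ρ , c , p) → false ∷ ρ , left c , p }) (λ { (false ∷ ρ , left c , p) → ρ , c , p })
      (λ { (false ∷ ρ , left c , p) → refl }) (λ _ → refl))))
E↔Col (false ∷ []) P =
  mk↔ₛ′ (λ { (here p) → true ∷ [] , right nil , p }) (λ { (true ∷ [] , right nil , p) → here p })
  (λ { (true ∷ [] , right nil , p) → refl }) (λ { (here p) → refl })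
E↔Col (false ∷ true ∷ ε) P =
  ↔-trans (Any-≡ (cong (map R) (E-false-true ε))) (↔-trans (Any-map-R∷ false P (E (true ∷ ε)))
  (↔-trans (E↔Col (true ∷ ε) (P ∘ (true ∷_)))
    (mk↔ₛ′ (λ { (ρ , c , p) → true ∷ ρ , right c , p }) (λ { (true ∷ ρ , right c , p) → ρ , c , p })
      (λ { (true ∷ ρ , right c , p) → refl }) (λ _ → refl))))
E↔Col (false ∷ false ∷ ε) P =
  ↔-trans (Any-≡ (trans (cong (map R) (E-false-false ε)) (map-++ R (map (false ∷_) (E (false ∷ ε))) _)))
  (↔-trans (↔-sym ++↔)
  (↔-trans
    (↔-trans (Any-map-R∷ false P (E (false ∷ ε))) (E↔Col (false ∷ ε) (P ∘ (true ∷_)))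
     ⊎-cong
     -- Both cells of a raised pair are covered, so two leading ones are stripped before the
     -- recursion.
     ↔-trans (Any-map-R∷ true P (E (true ∷ ε)))
       (↔-trans (Any-≡ (cong (map R) (E-true ε)))
         (↔-trans (Any-map-R∷ true (P ∘ (false ∷_)) (E ε)) (E↔Col ε (P ∘ (λ ρ → false ∷ false ∷ ρ))))))
    (mk↔ₛ′
      (λ { (inj₁ (ρ , c , p)) → true ∷ ρ , right c , p
         ; (inj₂ (ρ , c , p)) → false ∷ false ∷ ρ , vert c , p })
      (λ { (true ∷ ρ , right c , p) → inj₁ (ρ , c , p)
         ; (false ∷ false ∷ ρ , vert c , p) → inj₂ (ρ , c , p) })
      (λ { (true ∷ ρ , right c , p) → refl ; (false ∷ false ∷ ρ , vert c , p) → refl })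
      (λ { (inj₁ _) → refl ; (inj₂ _) → refl }))))

-- First e₁ e₂ a and Last e₁ e₂ b: the two outermost cells of a column, with
-- covering e₁ e₂, reduce to the covering a (b) of the cell that has a right neighbour.
data First : Bool → Bool → Bool → Set where
  f00 : First false false true
  f10 : First true  false false
  f11 : First true  true  true

data Last : Bool → Bool → Bool → Set where
  l00 : Last false false true
  l01 : Last false true  false
  l11 : Last true  true  true

-- An end cell not covered from the left cannot go right either, so it shares a vertical domino with
-- its neighbour, which from then on counts as covered. An end cell covered from the left leaves its
-- neighbour unchanged.
first-drop : ∀ {m e₁ e₂ a} {ε : Bits m} {ρ} → First e₁ e₂ a →
             Col (e₁ ∷ e₂ ∷ ε) (false ∷ ρ) → Col (a ∷ ε) ρ
first-drop f00 (vert c) = left c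
first-drop f10 (left c) = c
first-drop f11 (left c) = c

first-add : ∀ {m e₁ e₂ a} {ε : Bits m} {ρ} → First e₁ e₂ a →
            Col (a ∷ ε) ρ → Col (e₁ ∷ e₂ ∷ ε) (false ∷ ρ)
first-add f00 (left c) = vert c
first-add f10 c        = left c
first-add f11 c        = left c

first-blocked : ∀ {m} {ε : Bits m} {ρ} → ¬ Col (false ∷ true ∷ ε) (false ∷ ρ)
first-blocked ()

-- `Col` is built from the first cell, so a change at the far end is carried through the whole
-- column. A vertical domino takes two cells at a time, hence the separate clauses for a single cell
-- before the end.
last-drop : ∀ {m e₁ e₂ b} (ε : Bits m) (ρ : Bits (suc m)) → Last e₁ e₂ b →
            Col ((ε ∷ʳ e₁) ∷ʳ e₂) (ρ ∷ʳ false) → Col (ε ∷ʳ b) ρ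
last-drop []          (_ ∷ [])    l00 (right ())
last-drop []          (_ ∷ [])    l00 (vert nil)         = left nil
last-drop []          (_ ∷ [])    l01 (right (left nil)) = right nil
last-drop []          (_ ∷ [])    l11 (left (left nil))  = left nil
last-drop (_ ∷ [])    (_ ∷ ρ@(_ ∷ [])) l (left c)  = left (last-drop [] ρ l c)
last-drop (_ ∷ [])    (_ ∷ ρ@(_ ∷ [])) l (right c) = right (last-drop [] ρ l c)
-- Here a vertical domino ends on the next-to-last cell. The last cell must then be covered from the
-- left, which leaves only `l01`.
last-drop (_ ∷ [])    (_ ∷ _ ∷ [])   l01 (vert (left nil)) = vert nil
last-drop (_ ∷ ε@(_ ∷ _)) (_ ∷ ρ@(_ ∷ _)) l (left c)  = left (last-drop ε ρ l c)
last-drop (_ ∷ ε@(_ ∷ _)) (_ ∷ ρ@(_ ∷ _)) l (right c) = right (last-drop ε ρ l c)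
last-drop (_ ∷ _ ∷ ε) (_ ∷ _ ∷ ρ)     l (vert c)  = vert (last-drop ε ρ l c)

last-add : ∀ {m e₁ e₂ b} (ε : Bits m) (ρ : Bits (suc m)) → Last e₁ e₂ b →
           Col (ε ∷ʳ b) ρ → Col ((ε ∷ʳ e₁) ∷ʳ e₂) (ρ ∷ʳ false)
last-add []          (_ ∷ [])     l00 (left nil)  = vert nil
last-add []          (_ ∷ [])     l01 (right nil) = right (left nil)
last-add []          (_ ∷ [])     l11 (left nil)  = left (left nil)
last-add (_ ∷ [])    (_ ∷ ρ@(_ ∷ [])) l (left c)  = left (last-add [] ρ l c)
last-add (_ ∷ [])    (_ ∷ ρ@(_ ∷ [])) l (right c) = right (last-add [] ρ l c)
last-add (_ ∷ [])    (_ ∷ _ ∷ [])   l01 (vert nil) = vert (left nil)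
last-add (_ ∷ ε@(_ ∷ _)) (_ ∷ ρ@(_ ∷ _)) l (left c)  = left (last-add ε ρ l c)
last-add (_ ∷ ε@(_ ∷ _)) (_ ∷ ρ@(_ ∷ _)) l (right c) = right (last-add ε ρ l c)
last-add (_ ∷ _ ∷ ε) (_ ∷ _ ∷ ρ)     l (vert c)  = vert (last-add ε ρ l c)

last-blocked : ∀ {m} (ε : Bits m) (ρ : Bits (suc m)) →
               ¬ Col ((ε ∷ʳ true) ∷ʳ false) (ρ ∷ʳ false)
last-blocked []          (_ ∷ [])    (left ())
last-blocked (_ ∷ [])    (_ ∷ ρ@(_ ∷ [])) (left c)  = last-blocked [] ρ c
last-blocked (_ ∷ [])    (_ ∷ ρ@(_ ∷ [])) (right c) = last-blocked [] ρ c
last-blocked (_ ∷ ε@(_ ∷ _)) (_ ∷ ρ@(_ ∷ _)) (left c)  = last-blocked ε ρ c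
last-blocked (_ ∷ ε@(_ ∷ _)) (_ ∷ ρ@(_ ∷ _)) (right c) = last-blocked ε ρ c
last-blocked (_ ∷ _ ∷ ε) (_ ∷ _ ∷ ρ) (vert c)  = last-blocked ε ρ c

lastTwo-∷ʳ : ∀ {k} (xs : Bits (suc (suc k))) →
             let (mid , y , z) = lastTwo xs in xs ≡ (mid ∷ʳ y) ∷ʳ z
lastTwo-∷ʳ {zero}  (x ∷ y ∷ []) = refl
lastTwo-∷ʳ {suc k} (x ∷ xs)     = cong (x ∷_) (lastTwo-∷ʳ xs)

-- The top and bottom cells of a column have no right neighbour.
Link : ∀ {m} → Bits (suc (suc m)) → Bits m → Set
Link ε ρ = Col ε (false ∷ (ρ ∷ʳ false))

-- `K` sends a basis element to one basis element or to 0. In the first case the image must admit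
-- the same next columns as `ε`; in the second, `ε` must admit none.
K-spec : ∀ {k} → Bits (suc (suc (suc (suc k)))) → List (Bits (suc (suc k))) → Set
K-spec ε L =
  (Σ _ λ η → L ≡ [ η ] × (∀ ρ → (Col η ρ → Link ε ρ) × (Link ε ρ → Col η ρ)))
  ⊎ (L ≡ [] × (∀ ρ → ¬ Link ε ρ))

keep-ends : ∀ {m e₁ e₂ a y z b} (mid : Bits m) → First e₁ e₂ a → Last y z b → ∀ ρ →
  let ε = e₁ ∷ e₂ ∷ ((mid ∷ʳ y) ∷ʳ z)
      η = a ∷ (mid ∷ʳ b)
  in (Col η ρ → Link ε ρ) × (Link ε ρ → Col η ρ)
keep-ends {a = a} mid f l ρ = (λ c → first-add f (last-add (a ∷ mid) ρ l c))
                            , (λ c → last-drop (a ∷ mid) ρ l (first-drop f c))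

block-end : ∀ {m e₁ e₂ a} (mid : Bits m) → First e₁ e₂ a → ∀ ρ →
            ¬ Link (e₁ ∷ e₂ ∷ ((mid ∷ʳ true) ∷ʳ false)) ρ
block-end {a = a} mid f ρ c = last-blocked (a ∷ mid) ρ (first-drop f c)

K-correct : ∀ {k} (ε : Bits (suc (suc (suc (suc k))))) → K-spec ε (K ε)
K-correct (e₁ ∷ e₂ ∷ rest) with e₁ | e₂ | lastTwo rest | lastTwo-∷ʳ rest
... | false | true  | mid , y     , z     | _    = inj₂ (refl , λ _ → first-blocked)
... | false | false | mid , false , false | refl = inj₁ (_ , refl , keep-ends mid f00 l00)
... | false | false | mid , false , true  | refl = inj₁ (_ , refl , keep-ends mid f00 l01)
... | false | false | mid , true  , false | refl = inj₂ (refl , block-end mid f00)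
... | false | false | mid , true  , true  | refl = inj₁ (_ , refl , keep-ends mid f00 l11)
... | true  | false | mid , false , false | refl = inj₁ (_ , refl , keep-ends mid f10 l00)
... | true  | false | mid , false , true  | refl = inj₁ (_ , refl , keep-ends mid f10 l01)
... | true  | false | mid , true  , false | refl = inj₂ (refl , block-end mid f10)
... | true  | false | mid , true  , true  | refl = inj₁ (_ , refl , keep-ends mid f10 l11)
... | true  | true  | mid , false , false | refl = inj₁ (_ , refl , keep-ends mid f11 l00)
... | true  | true  | mid , false , true  | refl = inj₁ (_ , refl , keep-ends mid f11 l01)
... | true  | true  | mid , true  , false | refl = inj₂ (refl , block-end mid f11)
... | true  | true  | mid , true  , true  | refl = inj₁ (_ , refl , keep-ends mid f11 l11)

Any-K↔Link : ∀ {k} (ε : Bits (suc (suc (suc (suc k))))) (ρ : Bits (suc (suc k))) →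
             Any (λ η → Col η ρ) (K ε) ↔ Link ε ρ
Any-K↔Link ε ρ with K ε | K-correct ε
... | _ | inj₁ (η , refl , equiv) =
  mk↔ₛ′ (λ { (here c) → proj₁ (equiv ρ) c ; (there ()) }) (λ c → here (proj₂ (equiv ρ) c))
    (λ _ → Col-irrelevant _ _) (λ { (here _) → cong here (Col-irrelevant _ _) ; (there ()) })
... | _ | inj₂ (refl , blocked) =
  mk↔ₛ′ (λ ()) (λ c → ⊥-elim (blocked ρ c)) (λ c → ⊥-elim (blocked ρ c)) (λ ())

-- Brings the next column in front of the choice made by `K`, so that `Any-K↔Link` applies with that
-- column fixed.
Any-Σ↔ : {A B : Set} {Q : A → B → Set} {P : B → Set} (xs : List A) →
         Any (λ x → Σ B λ y → Q x y × P y) xs ↔ Σ B (λ y → Any (λ x → Q x y) xs × P y)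
Any-Σ↔ {A} {B} {Q} {P} xs = mk↔ₛ′ pull (push xs) (pull∘push xs) push∘pull
  where
  pull : ∀ {xs} → Any (λ x → Σ B λ y → Q x y × P y) xs → Σ B (λ y → Any (λ x → Q x y) xs × P y)
  pull (here (y , q , p)) = y , here q , p
  pull (there i)          = let (y , j , p) = pull i in y , there j , p
  push : ∀ xs → Σ B (λ y → Any (λ x → Q x y) xs × P y) → Any (λ x → Σ B λ y → Q x y × P y) xs
  push (_ ∷ _)  (y , here q  , p) = here (y , q , p)
  push (_ ∷ xs) (y , there i , p) = there (push xs (y , i , p))
  pull∘push : ∀ xs s → pull (push xs s) ≡ s
  pull∘push (_ ∷ _)  (y , here q  , p) = refl
  pull∘push (_ ∷ xs) (y , there i , p) rewrite pull∘push xs (y , i , p) = refl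
  push∘pull : ∀ {xs} i → push xs (pull i) ≡ i
  push∘pull (here _)  = refl
  push∘pull (there i) = cong there (push∘pull i)

transfer↔ : ∀ {k} (ε : Bits (suc (suc (suc (suc k))))) (P : Bits (suc (suc k)) → Set) →
  Any P (concatMap (λ η → map R (E η)) (K ε)) ↔ Σ _ (λ ρ → Link ε ρ × P ρ)
transfer↔ ε P =
  ↔-trans (↔-sym concat↔) (↔-trans (↔-sym map↔)
  (↔-trans (Any-cong (λ η → E↔Col η P) ↔-refl)
  (↔-trans (Any-Σ↔ (K ε)) (congˡ (λ {ρ} → ×-cong (Any-K↔Link ε ρ) ↔-refl)))))

-- The links run from the column at the axis outwards and end at the empty column. The last of them
-- says that a column of height 2 sends nothing to the right, which is the condition expressed by
-- `C_1`: both cells are covered from the left, or one vertical domino covers them.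
Chain : ∀ n → Bits (dbl n) → Set
Chain zero    ε = ⊤
Chain (suc n) ε = Σ (Bits (dbl n)) λ ρ → Link ε ρ × Chain n ρ

Link-[]↔Chain : ∀ ε → Link ε [] ↔ Chain 1 ε
Link-[]↔Chain ε = mk↔ₛ′ (λ c → [] , c , _) (λ { ([] , c , _) → c }) (λ { ([] , c , _) → refl }) (λ _ → refl)

Cs↔Chain : ∀ k ε → Fin (Cs k ε) ↔ Chain (suc k) ε
Cs↔Chain zero ε@(false ∷ false ∷ []) = ↔-trans
  (mk↔ₛ′ (λ _ → vert nil) (λ _ → Fin.zero)
    (λ _ → Col-irrelevant _ _) (λ { Fin.zero → refl ; (Fin.suc ()) }))
  (Link-[]↔Chain ε)
Cs↔Chain zero (false ∷ true ∷ []) = mk↔ₛ′ (λ ()) (λ { ([] , () , _) }) (λ { ([] , () , _) }) (λ ())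
Cs↔Chain zero (true ∷ false ∷ []) =
  mk↔ₛ′ (λ ()) (λ { ([] , left () , _) }) (λ { ([] , left () , _) }) (λ ())
Cs↔Chain zero ε@(true ∷ true ∷ []) = ↔-trans
  (mk↔ₛ′ (λ _ → left (left nil)) (λ _ → Fin.zero)
    (λ _ → Col-irrelevant _ _) (λ { Fin.zero → refl ; (Fin.suc ()) }))
  (Link-[]↔Chain ε)
Cs↔Chain (suc k) ε =
  ↔-trans (sum↔Any (Cs k) _)
  (↔-trans (transfer↔ ε (Fin ∘ Cs k)) (congˡ (λ {ρ} → ×-cong ↔-refl (Cs↔Chain k ρ))))

normC↔Chain : ∀ k → Fin (normC (suc k)) ↔ Σ (Bits (dbl (suc k))) (Chain (suc k))
normC↔Chain k =
  ↔-trans (sum↔Any (Cs k) (allBits (dbl (suc k))))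
  (↔-trans (allBits↔ _ (Fin ∘ Cs k)) (congˡ (λ {ε} → Cs↔Chain k ε)))

-- Tilings of the right half as chains of columns

isLeft isRight : Maybe Dir → Bool
isLeft (just left) = true
isLeft _           = false
isRight (just right) = true
isRight _            = false

isLeft⇒ : ∀ {x} → isLeft x ≡ true → x ≡ just left
isLeft⇒ {just left} _ = refl

isRight⇒ : ∀ {x} → isRight x ≡ true → x ≡ just right
isRight⇒ {just right} _ = refl

nothing-unless : ∀ {x : Maybe Dir} {P : Set} → (∀ {d} → x ≡ just d → P) → ¬ P → x ≡ nothing
nothing-unless {nothing} _ _  = refl
nothing-unless {just d}  p ¬P = ⊥-elim (¬P (p refl))

tab : ∀ {A : Set} m → (ℕ → A) → Vec A m
tab zero    f = []
tab (suc m) f = f 0 ∷ tab m (f ∘ suc)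

tab-∷ʳ : ∀ {A : Set} m (f : ℕ → A) → tab (suc m) f ≡ tab m f ∷ʳ f m
tab-∷ʳ zero    f = refl
tab-∷ʳ (suc m) f = cong (f 0 ∷_) (tab-∷ʳ m (f ∘ suc))

tab-cong : ∀ {A : Set} m {f g : ℕ → A} → (∀ b → f b ≡ g b) → tab m f ≡ tab m g
tab-cong zero    eq = refl
tab-cong (suc m) eq = cong₂ _∷_ (eq 0) (tab-cong m (eq ∘ suc))

tab-injective : ∀ {A : Set} m {f g : ℕ → A} → tab m f ≡ tab m g → ∀ {b} → b < m → f b ≡ g b
tab-injective (suc m) eq {zero}  _         = proj₁ (∷-injective eq)
tab-injective (suc m) eq {suc b} (s≤s b<m) = tab-injective m (proj₂ (∷-injective eq)) b<m

-- Directions along a column, continued by `nothing` above height `m`. A `down` in row 0 is not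
-- excluded here, so that tails which cut a vertical domino are still columns; lemmas that must
-- exclude it assume so separately.
record Column (m : ℕ) (w : ℕ → Maybe Dir) : Set where
  field
    none : ∀ {b} → w b ≡ nothing → m ≤ b
    some : ∀ {b d} → w b ≡ just d → b < m
    up⇒down : ∀ {b} → w b ≡ just up → w (suc b) ≡ just down
    down⇒up : ∀ {b} → w (suc b) ≡ just down → w b ≡ just up

  outside : ∀ {b} → m ≤ b → w b ≡ nothing
  outside m≤b = nothing-unless some (λ b<m → <⇒≱ b<m m≤b)

open Column

Column-tail : ∀ {m w} → Column (suc m) w → Column m (w ∘ suc)
Column-tail C .none eq with none C eq
... | s≤s m≤b = m≤b
Column-tail C .some eq with some C eq
... | s≤s b<m = b<m
Column-tail C .up⇒down = up⇒down C
Column-tail C .down⇒up = down⇒up C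

next≢down : ∀ {m w d} → Column m w → w 0 ≡ just d → d ≢ up → w 1 ≢ just down
next≢down C eq d≢up p = d≢up (just-injective (trans (sym eq) (down⇒up C p)))

-- Read upwards, each `up` is consumed together with the `down` above it. What remains never starts
-- with `down`, because the cell just below is not an `up`.
Column⇒Col : ∀ m {w} → Column m w → w 0 ≢ just down →
             Col (tab m (isLeft ∘ w)) (tab m (isRight ∘ w))
Column⇒Col zero C _ = nil
Column⇒Col (suc m) {w} C d with w 0 in eq
... | nothing with none C eq
...   | ()
Column⇒Col (suc m) C d | just left  = left (Column⇒Col m (Column-tail C) (next≢down C eq λ ()))
Column⇒Col (suc m) C d | just right = right (Column⇒Col m (Column-tail C) (next≢down C eq λ ()))
Column⇒Col (suc m) C d | just down  = ⊥-elim (d refl)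
-- The partner of the `up` lies in the column, which forces height at least 2.
Column⇒Col (suc m) {w} C d | just up with some C (up⇒down C eq)
Column⇒Col (suc (suc m)) {w} C d | just up | s≤s (s≤s _) with w 1 in eq₁ | up⇒down C eq
... | _ | refl = vert (Column⇒Col m (Column-tail (Column-tail C)) (next≢down (Column-tail C) eq₁ λ ()))

word : ∀ {m} {ε ρ : Bits m} → Col ε ρ → ℕ → Maybe Dir
word nil       _             = nothing
word (left c)  zero          = just left
word (left c)  (suc b)       = word c b
word (right c) zero          = just right
word (right c) (suc b)       = word c b
word (vert c)  zero          = just up
word (vert c)  (suc zero)    = just down
word (vert c)  (suc (suc b)) = word c b

word-lefts : ∀ {m} {ε ρ : Bits m} (c : Col ε ρ) → tab m (isLeft ∘ word c) ≡ ε
word-lefts nil       = refl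
word-lefts (left c)  = cong (true ∷_) (word-lefts c)
word-lefts (right c) = cong (false ∷_) (word-lefts c)
word-lefts (vert c)  = cong (λ ε → false ∷ false ∷ ε) (word-lefts c)

word-rights : ∀ {m} {ε ρ : Bits m} (c : Col ε ρ) → tab m (isRight ∘ word c) ≡ ρ
word-rights nil       = refl
word-rights (left c)  = cong (false ∷_) (word-rights c)
word-rights (right c) = cong (true ∷_) (word-rights c)
word-rights (vert c)  = cong (λ ρ → false ∷ false ∷ ρ) (word-rights c)

word-down₀ : ∀ {m} {ε ρ : Bits m} (c : Col ε ρ) → word c 0 ≢ just down
word-down₀ nil       ()
word-down₀ (left c)  ()
word-down₀ (right c) ()
word-down₀ (vert c)  ()

Column-∷ : ∀ {m w} → Column m (w ∘ suc) → ∀ {d} → w 0 ≡ just d →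
           (d ≡ up → w 1 ≡ just down) → (w 1 ≡ just down → d ≡ up) → Column (suc m) w
Column-∷ C eq u d .none {zero} p with trans (sym eq) p
... | ()
Column-∷ C eq u d .none {suc b} p = s≤s (none C p)
Column-∷ C eq u d .some {zero} p = s≤s z≤n
Column-∷ C eq u d .some {suc b} p = s≤s (some C p)
Column-∷ C eq u d .up⇒down {zero} p with trans (sym eq) p
... | refl = u refl
Column-∷ C eq u d .up⇒down {suc b} p = up⇒down C p
Column-∷ C eq u d .down⇒up {zero} p = trans eq (cong just (d p))
Column-∷ C eq u d .down⇒up {suc b} p = down⇒up C p

word-Column : ∀ {m} {ε ρ : Bits m} (c : Col ε ρ) → Column m (word c)
word-Column nil = record { none = λ _ → z≤n ; some = λ () ; up⇒down = λ () ; down⇒up = λ () }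
word-Column (left c)  =
  Column-∷ (word-Column c) refl (λ ()) (λ p → ⊥-elim (word-down₀ c p))
word-Column (right c) =
  Column-∷ (word-Column c) refl (λ ()) (λ p → ⊥-elim (word-down₀ c p))
word-Column (vert c)  =
  Column-∷ (Column-∷ (word-Column c) refl (λ ()) (λ p → ⊥-elim (word-down₀ c p)))
           refl (λ _ → refl) (λ _ → refl)

-- A set bit of `ε` or `ρ` fixes the entry directly. Where both are 0 the entry is vertical, and it
-- is `up` because no domino from below is still open.
word-unique : ∀ {m w} {ε ρ : Bits m} → Column m w → w 0 ≢ just down →
  tab m (isLeft ∘ w) ≡ ε → tab m (isRight ∘ w) ≡ ρ → (c : Col ε ρ) → ∀ b → word c b ≡ w b
word-unique C d _ _ nil b = sym (outside C z≤n)
word-unique C d p q (left c) = λ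
  { zero    → sym w₀
  ; (suc b) → word-unique (Column-tail C) (next≢down C w₀ λ ())
                (proj₂ (∷-injective p)) (proj₂ (∷-injective q)) c b }
  where
  w₀ = isLeft⇒ (proj₁ (∷-injective p))
word-unique C d p q (right c) = λ
  { zero    → sym w₀
  ; (suc b) → word-unique (Column-tail C) (next≢down C w₀ λ ())
                (proj₂ (∷-injective p)) (proj₂ (∷-injective q)) c b }
  where
  w₀ = isRight⇒ (proj₁ (∷-injective q))
word-unique {w = w} C d p q (vert c) = λ
  { zero          → sym w₀
  ; (suc zero)    → sym w₁
  ; (suc (suc b)) → word-unique (Column-tail (Column-tail C)) (next≢down (Column-tail C) w₁ λ ())
                      (proj₂ (∷-injective (proj₂ (∷-injective p))))
                      (proj₂ (∷-injective (proj₂ (∷-injective q)))) c b }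
  where
  only-up : ∀ x → x ≡ w 0 → isLeft x ≡ false → isRight x ≡ false → x ≡ just up
  only-up nothing e _ _ with none C (sym e)
  ... | ()
  only-up (just up)   _ _ _ = refl
  only-up (just down) e _ _ = ⊥-elim (d (sym e))
  w₀ : w 0 ≡ just up
  w₀ = only-up (w 0) refl (proj₁ (∷-injective p)) (proj₁ (∷-injective q))
  w₁ : w 1 ≡ just down
  w₁ = up⇒down C w₀

-- Region n i b: row b of column i lies in the right half of AD(n), both counted from 0
-- at the lowest square of the column adjacent to the axis.
Region : ℕ → ℕ → ℕ → Set
Region n       zero    b       = b < dbl n
Region zero    (suc i) b       = ⊥
Region (suc n) (suc i) zero    = ⊥
Region (suc n) (suc i) (suc b) = Region n i b

-- Dominoes of column 0 may protrude across the axis: nothing is asked of a left there.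
record HalfTiling (n : ℕ) (f : ℕ → ℕ → Maybe Dir) : Set where
  field
    none : ∀ {i b} → f i b ≡ nothing → ¬ Region n i b
    some : ∀ {i b d} → f i b ≡ just d → Region n i b
    up⇒down : ∀ {i b} → f i b ≡ just up → f i (suc b) ≡ just down
    down⇒up : ∀ {i b} → f i (suc b) ≡ just down → f i b ≡ just up
    down₀ : ∀ {i} → f i 0 ≢ just down
    across : ∀ i b → isRight (f i b) ≡ isLeft (f (suc i) b)

open HalfTiling

first-column : ∀ {n f} → HalfTiling n f → Column (dbl n) (f 0)
first-column H = record
  { none = λ p → ≮⇒≥ (none H p) ; some = some H ; up⇒down = up⇒down H ; down⇒up = down⇒up H }

-- Without its first column the right half of `AD(n + 1)` is a translate of that of `AD(n)`; the
-- next column starts one row higher, hence the shift in `b`.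
inner : (ℕ → ℕ → Maybe Dir) → ℕ → ℕ → Maybe Dir
inner f i b = f (suc i) (suc b)

suc-0-outside : ∀ {n f} → HalfTiling n f → ∀ i → f (suc i) 0 ≡ nothing
suc-0-outside {n} H i = nothing-unless (some H) (¬R n)
  where
  ¬R : ∀ n → ¬ Region n (suc i) 0
  ¬R zero    ()
  ¬R (suc n) ()

inner-HalfTiling : ∀ {n f} → HalfTiling (suc n) f → HalfTiling n (inner f)
inner-HalfTiling H .none p = none H p
inner-HalfTiling H .some p = some H p
inner-HalfTiling H .up⇒down p = up⇒down H p
inner-HalfTiling H .down⇒up p = down⇒up H p
-- The partner of such a `down` would lie in row 0 of a column other than the first, outside the
-- region.
inner-HalfTiling H .down₀ {i} p with trans (sym (suc-0-outside H i)) (down⇒up H p)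
... | ()
inner-HalfTiling H .across i b = across H (suc i) (suc b)

-- The next column is shorter by one cell at each end, so nothing sticks out at the two ends. This
-- is the shape that `Link` demands.
first-rights : ∀ {n f} → HalfTiling (suc n) f →
  tab (dbl (suc n)) (isRight ∘ f 0) ≡ false ∷ (tab (dbl n) (isLeft ∘ inner f 0) ∷ʳ false)
first-rights {n} {f} H =
  trans (tab-cong (dbl (suc n)) (across H 0))
  (cong₂ _∷_ (cong isLeft (suc-0-outside H 0))
    (trans (tab-∷ʳ (dbl n) (isLeft ∘ inner f 0))
      (cong (λ x → tab (dbl n) (isLeft ∘ inner f 0) ∷ʳ isLeft x)
        (outside (first-column (inner-HalfTiling H)) ≤-refl))))

lefts : ∀ n → (ℕ → ℕ → Maybe Dir) → Bits (dbl n)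
lefts n f = tab (dbl n) (isLeft ∘ f 0)

chain : ∀ n {f} → HalfTiling n f → Chain n (lefts n f)
chain zero    H = tt
chain (suc n) {f} H =
    lefts n (inner f)
  , subst (Col _) (first-rights H) (Column⇒Col (dbl (suc n)) (first-column H) (down₀ H))
  , chain n (inner-HalfTiling H)

pad : (ℕ → Maybe Dir) → ℕ → Maybe Dir
pad w zero    = nothing
pad w (suc b) = w b

entries : ∀ n {ε} → Chain n ε → ℕ → ℕ → Maybe Dir
entries zero    _            i       b = nothing
entries (suc n) (ρ , c , ch) zero    b = word c b
entries (suc n) (ρ , c , ch) (suc i) b = pad (entries n ch i) b

entries-lefts : ∀ n {ε} (ch : Chain n ε) → lefts n (entries n ch) ≡ ε
entries-lefts zero    {[]} _       = refl
entries-lefts (suc n) (ρ , c , ch) = word-lefts c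

entries-HalfTiling : ∀ n {ε} (ch : Chain n ε) → HalfTiling n (entries n ch)
entries-HalfTiling zero _ = record
  { none = λ { {zero} _ () ; {suc i} _ () } ; some = λ () ; up⇒down = λ () ; down⇒up = λ ()
  ; down₀ = λ () ; across = λ _ _ → refl }
entries-HalfTiling (suc n) (ρ , c , ch) = record
  { none = λ { {zero} p → λ r → <⇒≱ r (none W p)
             ; {suc i} {zero} p → λ ()
             ; {suc i} {suc b} p → none H p }
  ; some = λ { {zero} p → some W p ; {suc i} {suc b} p → some H p }
  ; up⇒down = λ { {zero} p → up⇒down W p ; {suc i} {suc b} p → up⇒down H p }
  ; down⇒up = λ { {zero} p → down⇒up W p
                ; {suc i} {zero} p → ⊥-elim (down₀ H p)
                ; {suc i} {suc b} p → down⇒up H p }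
  ; down₀ = λ { {zero} p → word-down₀ c p ; {suc i} () }
  ; across = λ { zero → across₀ ; (suc i) zero → refl ; (suc i) (suc b) → across H i b }
  }
  where
  W = word-Column c
  H = entries-HalfTiling n ch
  D = first-column H
  rights : tab (dbl (suc n)) (isRight ∘ word c) ≡ tab (dbl (suc n)) (isLeft ∘ pad (entries n ch 0))
  rights = trans (word-rights c) (cong (false ∷_) (sym
    (trans (tab-∷ʳ (dbl n) (isLeft ∘ entries n ch 0))
      (cong₂ _∷ʳ_ (entries-lefts n ch) (cong isLeft (outside D ≤-refl))))))
  across₀ : ∀ b → isRight (word c b) ≡ isLeft (pad (entries n ch 0) b)
  -- The bit sequences decide only the rows inside the column; above it both entries are `nothing`.
  across₀ b with b <? dbl (suc n)
  ... | yes b<m = tab-injective (dbl (suc n)) {isRight ∘ word c} {isLeft ∘ pad (entries n ch 0)}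
                    rights b<m
  across₀ zero | no b≮m = ⊥-elim (b≮m (s≤s z≤n))
  across₀ (suc b) | no b≮m
    rewrite outside W (≮⇒≥ b≮m)
          | outside D {b} (≤-trans (n≤1+n _) (s≤s⁻¹ (≮⇒≥ b≮m))) = refl

entries-chain : ∀ n {f} (H : HalfTiling n f) → ∀ i b → entries n (chain n H) i b ≡ f i b
entries-chain zero H i b = sym (nothing-unless (some H) (¬R i))
  where
  ¬R : ∀ i → ¬ Region 0 i b
  ¬R zero    ()
  ¬R (suc i) ()
entries-chain (suc n) H zero b =
  word-unique (first-column H) (down₀ H) refl (first-rights H)
    (proj₁ (proj₂ (chain (suc n) H))) b
entries-chain (suc n) H (suc i) zero    = sym (suc-0-outside H i)
entries-chain (suc n) H (suc i) (suc b) = entries-chain n (inner-HalfTiling H) i b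

-- Stated for any half tiling that agrees pointwise with the entries, since this passes to `inner`.
-- The equality is one of pairs because the first column indexes the type of the chain.
chain-entries : ∀ n {ε} (ch : Chain n ε) {f} (H : HalfTiling n f) →
  (∀ i b → f i b ≡ entries n ch i b) → (lefts n f , chain n H) ≡ (Σ _ (Chain n) ∋ (ε , ch))
chain-entries zero {[]} tt H eq = refl
chain-entries (suc n) (ρ , c , ch) H eq =
  cons (trans (tab-cong (dbl (suc n)) (λ b → cong isLeft (eq 0 b))) (word-lefts c))
       (chain-entries n ch (inner-HalfTiling H) (λ i b → eq (suc i) (suc b)))
  where
  cons : ∀ {ε ε′ ρ ρ′ c c′ ch ch′} → ε ≡ ε′ → (ρ , ch) ≡ (Σ _ (Chain n) ∋ (ρ′ , ch′)) →
         (ε , ρ , c , ch) ≡ (Σ _ (Chain (suc n)) ∋ (ε′ , ρ′ , c′ , ch′))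
  cons {c = c} {c′} refl refl rewrite Col-irrelevant c c′ = refl

-- The region in coordinates

-- Lattice coordinates are box indices minus `n + 1`, so absolute values become distances of natural
-- numbers.
Corner : ℕ → ℕ → ℕ → Set
Corner n x y = ∣ x - suc n ∣ + ∣ y - suc n ∣ ≤ suc n

Square : ℕ → ℕ → ℕ → Set
Square n a b = Corner n a b × Corner n (suc a) b × Corner n a (suc b) × Corner n (suc a) (suc b)

∣⊖∣ : ∀ m n → ℤ.∣ m ℤ.⊖ n ∣ ≡ ∣ m - n ∣
∣⊖∣ m       zero    = sym (∣-∣-identityʳ m)
∣⊖∣ zero    (suc n) = refl
∣⊖∣ (suc m) (suc n) = trans (cong ℤ.∣_∣ (ℤ.[1+m]⊖[1+n]≡m⊖n m n)) (∣⊖∣ m n)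

∣coord∣ : ∀ {n} (a : Fin (box n)) → ℤ.∣ coord {n} a ∣ ≡ ∣ toℕ a - suc n ∣
∣coord∣ {n} a = ∣⊖∣ (toℕ a) (suc n)

∣coord+1∣ : ∀ {n} (a : Fin (box n)) → ℤ.∣ coord {n} a ℤ.+ ℤ.+ 1 ∣ ≡ ∣ suc (toℕ a) - suc n ∣
∣coord+1∣ {n} a =
  trans (cong ℤ.∣_∣ (trans (ℤ.+-comm (coord {n} a) (ℤ.+ 1)) (ℤ.distribʳ-⊖-+-pos 1 (toℕ a) (suc n))))
        (∣⊖∣ (suc (toℕ a)) (suc n))

inRegion⇔ : ∀ n x y {u v} → ℤ.∣ x ∣ ≡ u → ℤ.∣ y ∣ ≡ v → T (inRegion n x y) ⇔ u + v ≤ suc n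
inRegion⇔ n x y refl refl =
  mk⇔ (toWitness {a? = _ ≤? _}) (fromWitness {a? = ℤ.∣ x ∣ + ℤ.∣ y ∣ ≤? suc n})

inAD⇔Square : ∀ n a b → T (inAD n a b) ⇔ Square n (toℕ a) (toℕ b)
inAD⇔Square n a b = mk⇔
  (λ t → let (t₁ , t′) = to T-∧ t ; (t₂ , t″) = to T-∧ t′ ; (t₃ , t₄) = to T-∧ t″
         in to r₁ t₁ , to r₂ t₂ , to r₃ t₃ , to r₄ t₄)
  (λ (c₁ , c₂ , c₃ , c₄) →
     from T-∧ (from r₁ c₁ , from T-∧ (from r₂ c₂ , from T-∧ (from r₃ c₃ , from r₄ c₄))))
  where
  i = coord {n} a
  j = coord {n} b
  r₁ = inRegion⇔ n i j (∣coord∣ {n} a) (∣coord∣ {n} b)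
  r₂ = inRegion⇔ n (i ℤ.+ ℤ.+ 1) j (∣coord+1∣ {n} a) (∣coord∣ {n} b)
  r₃ = inRegion⇔ n i (j ℤ.+ ℤ.+ 1) (∣coord∣ {n} a) (∣coord+1∣ {n} b)
  r₄ = inRegion⇔ n (i ℤ.+ ℤ.+ 1) (j ℤ.+ ℤ.+ 1) (∣coord+1∣ {n} a) (∣coord+1∣ {n} b)

dbl≡+ : ∀ n → dbl n ≡ n + n
dbl≡+ zero    = refl
dbl≡+ (suc n) = cong suc (trans (cong suc (dbl≡+ n)) (sym (+-suc n n)))

-- The upper right corner alone gives both strict bounds.
Square⇒box : ∀ {n} a b → Square n a b → a < box n × b < box n
Square⇒box {n} a b (_ , _ , _ , c) =
    bound (suc a) (m+n≤o⇒m≤o ∣ a - n ∣ c)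
  , bound (suc b) (m+n≤o⇒n≤o ∣ a - n ∣ c)
  where
  bound : ∀ x → ∣ x - suc n ∣ ≤ suc n → x ≤ box n
  bound x p = subst (x ≤_) (sym (dbl≡+ (suc n)))
    (≤-trans (m≤n+∣m-n∣ x (suc n)) (+-monoʳ-≤ (suc n) p))

-- At distance n + 1 from a coordinate axis the region is a single point, which cannot be
-- two corners of a square.
coords-collapse : ∀ {n x} → ∣ x - suc n ∣ + suc n ≤ suc n → ∣ suc x - suc n ∣ + suc n ≤ suc n → ⊥
coords-collapse {n} {x} p q = 1+n≢n (trans (eq (suc x) q) (sym (eq x p)))
  where
  eq : ∀ y → ∣ y - suc n ∣ + suc n ≤ suc n → y ≡ suc n
  eq y r = ∣m-n∣≡0⇒m≡n {y} (n≤0⇒n≡0 (+-cancelʳ-≤ (suc n) _ 0 r))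

¬Square-row₀ : ∀ {n a} → ¬ Square n a 0
¬Square-row₀ {n} {a} (p , q , _) = coords-collapse {n} {a} p q

¬Square-column₀ : ∀ {n b} → ¬ Square n 0 b
¬Square-column₀ {n} {b} (p , _ , q , _) =
  coords-collapse {n} {b} (swap p) (swap q)
  where
  swap : ∀ {x} → suc n + x ≤ suc n → x + suc n ≤ suc n
  swap {x} = subst (_≤ suc n) (+-comm (suc n) x)

-- The region's inequality at the two corners farther from the axis, with the common 1 cancelled:
-- their distance from it is `i + 1`, and their heights are `b - n` and `b + 1 - n`.
Near : ℕ → ℕ → ℕ → Set
Near n i b = i + ∣ b - n ∣ ≤ n × i + ∣ suc b - n ∣ ≤ n

-- Peeling off a column lowers `n`, `i` and `b` together, which leaves the distance between `b` and
-- `n` unchanged.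
Region⇔Near : ∀ n i b → Region n i b ⇔ Near n i b
Region⇔Near n zero b = mk⇔
  (λ b<2n → near (<⇒≤ (≤2n b<2n)) , near (≤2n b<2n))
  (λ (_ , p) → subst (b <_) (sym (dbl≡+ n)) (≤-trans (m≤n+∣m-n∣ (suc b) n) (+-monoʳ-≤ n p)))
  where
  ≤2n : b < dbl n → suc b ≤ n + n
  ≤2n = subst (b <_) (dbl≡+ n)
  near : ∀ {x} → x ≤ n + n → ∣ x - n ∣ ≤ n
  near {x} x≤2n with ≤-total x n
  ... | inj₁ x≤n = subst (_≤ n) (sym (m≤n⇒∣m-n∣≡n∸m x≤n)) (m∸n≤m n x)
  ... | inj₂ n≤x = subst (_≤ n) (sym (m≤n⇒∣n-m∣≡n∸m n≤x)) (m≤n+o⇒m∸n≤o x n x≤2n)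
Region⇔Near zero    (suc i) b    = mk⇔ (λ ()) (λ { (() , _) })
Region⇔Near (suc n) (suc i) zero = mk⇔ (λ ()) (λ (p , _) → 1+n≰n (m+n≤o⇒n≤o i (s≤s⁻¹ p)))
Region⇔Near (suc n) (suc i) (suc b) = mk⇔
  (λ r → let (p , q) = to (Region⇔Near n i b) r in s≤s p , s≤s q)
  (λ (p , q) → from (Region⇔Near n i b) (s≤s⁻¹ p , s≤s⁻¹ q))

-- Columns are numbered outwards from the axis on both sides, so the mirror images `n + 1 + i` and
-- `n - i` share the number `i`.
data Side (n a : ℕ) : Set where
  rightOf : ∀ i → i + suc n ≡ a → Side n a
  leftOf  : ∀ i → a + i ≡ n → Side n a

column : ∀ {n a} → Side n a → ℕ
column (rightOf i _) = i
column (leftOf  i _) = i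

side : ∀ n a → Side n a
side n a with a ≤? n
... | yes a≤n = leftOf (n ∸ a) (m+[n∸m]≡n a≤n)
... | no a≰n  = rightOf (a ∸ suc n) (m∸n+n≡m (≰⇒> a≰n))

∣m+n-n∣≡m : ∀ m n → ∣ m + n - n ∣ ≡ m
∣m+n-n∣≡m m n = trans (cong (∣_- n ∣) (+-comm m n))
  (trans (∣-∣-comm (n + m) n) (∣m-m+n∣≡n n m))

-- The vertical sides of the square are at distances `i` and `i + 1` from the axis, in an order
-- depending on the side. The two farther corners imply the nearer ones.
Square⇔Region : ∀ {n a} (s : Side n a) b → Square n a (suc b) ⇔ Region n (column s) b
Square⇔Region {n} {a} s b = mk⇔ (from (Region⇔Near n i b) ∘ near) (square ∘ to (Region⇔Near n i b))
  where
  i = column s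
  ∣a∣ = ∣ a - suc n ∣
  ∣a+1∣ = ∣ a - n ∣
  distances : (∣a∣ ≡ i × ∣a+1∣ ≡ suc i) ⊎ (∣a∣ ≡ suc i × ∣a+1∣ ≡ i)
  distances = d s
    where
    d : (s : Side n a) → (∣ a - suc n ∣ ≡ column s × ∣ a - n ∣ ≡ suc (column s)) ⊎
                         (∣ a - suc n ∣ ≡ suc (column s) × ∣ a - n ∣ ≡ column s)
    d (rightOf i refl) = inj₁ (∣m+n-n∣≡m i (suc n)
      , trans (cong (∣_- n ∣) (+-suc i n)) (∣m+n-n∣≡m (suc i) n))
    d (leftOf i refl)  = inj₂ (trans (cong (∣ a -_∣) (sym (+-suc a i))) (∣m-m+n∣≡n a (suc i)) , ∣m-m+n∣≡n a i)
  near : Square n a (suc b) → Near n i b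
  near (p , q , p′ , q′) with distances
  ... | inj₁ (_ , eq) = s≤s⁻¹ (subst (λ x → x + ∣ b - n ∣ ≤ suc n) eq q)
                      , s≤s⁻¹ (subst (λ x → x + ∣ suc b - n ∣ ≤ suc n) eq q′)
  ... | inj₂ (eq , _) = s≤s⁻¹ (subst (λ x → x + ∣ b - n ∣ ≤ suc n) eq p)
                      , s≤s⁻¹ (subst (λ x → x + ∣ suc b - n ∣ ≤ suc n) eq p′)
  square : Near n i b → Square n a (suc b)
  square (p , q) with distances
  ... | inj₁ (eq , eq′) rewrite eq | eq′ = m≤n⇒m≤1+n p , s≤s p , m≤n⇒m≤1+n q , s≤s q
  ... | inj₂ (eq , eq′) rewrite eq | eq′ = s≤s p , m≤n⇒m≤1+n p , s≤s q , m≤n⇒m≤1+n q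

-- Grids as functions on ℕ × ℕ

Adjacent : Dir → ℕ → ℕ → ℕ → ℕ → Set
Adjacent up    a b a′ b′ = a ≡ a′ × suc b ≡ b′
Adjacent down  a b a′ b′ = a ≡ a′ × b ≡ suc b′
Adjacent right a b a′ b′ = suc a ≡ a′ × b ≡ b′
Adjacent left  a b a′ b′ = a ≡ suc a′ × b ≡ b′

toFin?-just : ∀ N m {x : Fin N} → toFin? N m ≡ just x → m ≡ toℕ x
toFin?-just N m eq with m <? N
toFin?-just N m refl | yes m<N = sym (toℕ-fromℕ< m<N)

toFin?-toℕ : ∀ {N} (x : Fin N) → toFin? N (toℕ x) ≡ just x
toFin?-toℕ {N} x with toℕ x <? N
... | yes p = cong just (fromℕ<-toℕ x p)
... | no ¬p = ⊥-elim (¬p (toℕ<n x))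

inc-just : ∀ {N} (x : Fin N) {y} → inc x ≡ just y → suc (toℕ x) ≡ toℕ y
inc-just x = toFin?-just _ (suc (toℕ x))

just-inc : ∀ {N} (x : Fin N) {y} → suc (toℕ x) ≡ toℕ y → inc x ≡ just y
just-inc x {y} eq rewrite eq = toFin?-toℕ y

dec-just : ∀ {N} (x : Fin N) {y} → dec x ≡ just y → toℕ x ≡ suc (toℕ y)
dec-just x eq with toℕ x
... | suc p = cong suc (toFin?-just _ p eq)

just-dec : ∀ {N} (x : Fin N) {y} → toℕ x ≡ suc (toℕ y) → dec x ≡ just y
just-dec x {y} eq with toℕ x
just-dec x {y} refl | suc _ = toFin?-toℕ y

step⇒Adjacent : ∀ {N} d (a b : Fin N) {a′ b′} → step d a b ≡ just (a′ , b′) →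
                Adjacent d (toℕ a) (toℕ b) (toℕ a′) (toℕ b′)
step⇒Adjacent up a b eq with inc b in q
step⇒Adjacent up a b refl | just _ = refl , inc-just b q
step⇒Adjacent down a b eq with dec b in q
step⇒Adjacent down a b refl | just _ = refl , dec-just b q
step⇒Adjacent right a b eq with inc a in q
step⇒Adjacent right a b refl | just _ = inc-just a q , refl
step⇒Adjacent left a b eq with dec a in q
step⇒Adjacent left a b refl | just _ = dec-just a q , refl

Adjacent⇒step : ∀ {N} d (a b : Fin N) {a′ b′} → Adjacent d (toℕ a) (toℕ b) (toℕ a′) (toℕ b′) →
                step d a b ≡ just (a′ , b′)
Adjacent⇒step up a b (p , q) rewrite toℕ-injective p | just-inc b q = refl
Adjacent⇒step down a b (p , q) rewrite toℕ-injective p | just-dec b q = refl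
Adjacent⇒step right a b (p , q) rewrite toℕ-injective q | just-inc a p = refl
Adjacent⇒step left a b (p , q) rewrite toℕ-injective q | just-dec a p = refl

Adjacent-unique : ∀ d {a b a′ b′ a″ b″} → Adjacent d a b a′ b′ → Adjacent d a b a″ b″ →
                  a′ ≡ a″ × b′ ≡ b″
Adjacent-unique up    (refl , refl) (refl , refl) = refl , refl
Adjacent-unique down  (refl , refl) (refl , refl) = refl , refl
Adjacent-unique right (refl , refl) (refl , refl) = refl , refl
Adjacent-unique left  (refl , refl) (refl , refl) = refl , refl

neighbour : ∀ {n} d a b → Square n a b → Σ ℕ λ a′ → Σ ℕ λ b′ → Adjacent d a b a′ b′
neighbour up    a b       s = _ , _ , refl , refl
neighbour {n} down a zero s = ⊥-elim (¬Square-row₀ {n} {a} s)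
neighbour down  a (suc b) s = _ , _ , refl , refl
neighbour right a b       s = _ , _ , refl , refl
neighbour {n} left zero b s = ⊥-elim (¬Square-column₀ {n} {b} s)
neighbour left  (suc a) b s = _ , _ , refl , refl

record Tiling (n : ℕ) (G : ℕ → ℕ → Maybe Dir) : Set where
  field
    none : ∀ {a b} → G a b ≡ nothing → ¬ Square n a b
    some : ∀ {a b d} → G a b ≡ just d → Square n a b
    partner : ∀ {a b d a′ b′} → G a b ≡ just d → Adjacent d a b a′ b′ → G a′ b′ ≡ just (opp d)

open Tiling

-- In a box of width `2n + 2` the mirror of `a` is `2n + 1 - a`; the sum avoids truncated
-- subtraction.
Symmetric : ℕ → (ℕ → ℕ → Maybe Dir) → Set
Symmetric n G = ∀ {a a′} b → a + a′ ≡ suc (dbl n) → G a′ b ≡ mapMaybe reflDir (G a b)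

T-not⇒ : ∀ {b} → T (not b) → ¬ T b
T-not⇒ {false} _ ()

⇒T-not : ∀ {b} → ¬ T b → T (not b)
⇒T-not {false} _ = _
⇒T-not {true}  ¬t = ¬t _

eqMDir⇒≡ : ∀ x y → T (eqMDir x y) → x ≡ y
eqMDir⇒≡ nothing      nothing      _ = refl
eqMDir⇒≡ (just up)    (just up)    _ = refl
eqMDir⇒≡ (just down)  (just down)  _ = refl
eqMDir⇒≡ (just left)  (just left)  _ = refl
eqMDir⇒≡ (just right) (just right) _ = refl

eqMDir-refl : ∀ x → T (eqMDir x x)
eqMDir-refl nothing      = _
eqMDir-refl (just up)    = _
eqMDir-refl (just down)  = _
eqMDir-refl (just left)  = _
eqMDir-refl (just right) = _

all-Fin⇒ : ∀ {N} (p : Fin N → Bool) → T (all p (allFin N)) → ∀ a → T (p a)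
all-Fin⇒ p t a = All.lookup (all⁺ p _ t) (∈-allFin a)

⇒all-Fin : ∀ {N} (p : Fin N → Bool) → (∀ a → T (p a)) → T (all p (allFin N))
⇒all-Fin {N} p t = all⁻ p (All.universal t (allFin N))

all-Fin²⇔ : ∀ {N} (p : Fin N → Fin N → Bool) →
  T (all (λ a → all (p a) (allFin N)) (allFin N)) ⇔ (∀ a b → T (p a b))
all-Fin²⇔ {N} p = mk⇔
  (λ t a b → all-Fin⇒ (p a) (all-Fin⇒ (λ a → all (p a) (allFin N)) t a) b)
  (λ t → ⇒all-Fin (λ a → all (p a) (allFin N)) (λ a → ⇒all-Fin (p a) (t a)))

-- The entry is an argument of its own, so that it can be exchanged for an equal one.
CellOK : ∀ n → Grid n → Fin (box n) → Fin (box n) → Maybe Dir → Set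
CellOK n g a b nothing  = ¬ Square n (toℕ a) (toℕ b)
CellOK n g a b (just d) = Square n (toℕ a) (toℕ b) × Σ (Fin (box n)) λ a′ → Σ (Fin (box n)) λ b′ →
  step d a b ≡ just (a′ , b′) × Square n (toℕ a′) (toℕ b′) × at {n} g a′ b′ ≡ just (opp d)

cellOK⇔ : ∀ n g a b → T (cellOK n g a b) ⇔ CellOK n g a b (at {n} g a b)
cellOK⇔ n g a b with at {n} g a b
... | nothing = mk⇔ (λ t → T-not⇒ t ∘ from (inAD⇔Square n a b)) (λ ¬s → ⇒T-not (¬s ∘ to (inAD⇔Square n a b)))
... | just d with step d a b
...   | nothing = mk⇔ (λ ()) (λ { (_ , _ , _ , () , _) })
...   | just (a′ , b′) = mk⇔
  (λ t → let (s , t′) = to T-∧ t ; (s′ , e) = to T-∧ t′ in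
     to (inAD⇔Square n a b) s , a′ , b′ , refl , to (inAD⇔Square n a′ b′) s′ , eqMDir⇒≡ _ _ e)
  (λ { (s , _ , _ , refl , s′ , e) →
     from T-∧ (from (inAD⇔Square n a b) s ,
       from T-∧ (from (inAD⇔Square n a′ b′) s′ ,
         subst (λ x → T (eqMDir x (just (opp d)))) (sym e) (eqMDir-refl (just (opp d))))) })

isTiling⇔ : ∀ n g → T (isTiling n g) ⇔ (∀ a b → CellOK n g a b (at {n} g a b))
isTiling⇔ n g = mk⇔
  (λ t a b → to (cellOK⇔ n g a b) (to (all-Fin²⇔ (cellOK n g)) t a b))
  (λ ok → from (all-Fin²⇔ (cellOK n g)) (λ a b → from (cellOK⇔ n g a b) (ok a b)))

isTInvariant⇔ : ∀ n g → T (isTInvariant n g) ⇔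
  (∀ a b → at {n} g (opposite a) b ≡ mapMaybe reflDir (at {n} g a b))
isTInvariant⇔ n g = mk⇔
  (λ t a b → eqMDir⇒≡ _ _ (to (all-Fin²⇔ p) t a b))
  (λ eq → from (all-Fin²⇔ p) (λ a b →
     subst (λ x → T (eqMDir x (mapMaybe reflDir (at {n} g a b)))) (sym (eq a b))
           (eqMDir-refl (mapMaybe reflDir (at {n} g a b)))))
  where
  p : Fin (box n) → Fin (box n) → Bool
  p a b = eqMDir (at {n} g (opposite a) b) (mapMaybe reflDir (at {n} g a b))

ext : ∀ n → Grid n → ℕ → ℕ → Maybe Dir
ext n g a b with a <? box n | b <? box n
... | yes p | yes q = at {n} g (fromℕ< p) (fromℕ< q)
... | _     | _     = nothing

ext-toℕ : ∀ n g a b → ext n g (toℕ a) (toℕ b) ≡ at {n} g a b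
ext-toℕ n g a b with toℕ a <? box n | toℕ b <? box n
... | yes p | yes q = cong₂ (at {n} g) (fromℕ<-toℕ a p) (fromℕ<-toℕ b q)
... | no ¬p | _     = ⊥-elim (¬p (toℕ<n a))
... | yes _ | no ¬q = ⊥-elim (¬q (toℕ<n b))

data Range (n : ℕ) : ℕ → ℕ → Set where
  inBox  : (a b : Fin (box n)) → Range n (toℕ a) (toℕ b)
  offBox : ∀ {a b} → ¬ (a < box n × b < box n) → Range n a b

range : ∀ n a b → Range n a b
range n a b with a <? box n | b <? box n
... | yes p | yes q = subst₂ (Range n) (toℕ-fromℕ< p) (toℕ-fromℕ< q) (inBox (fromℕ< p) (fromℕ< q))
... | no ¬p | _     = offBox (¬p ∘ proj₁)
... | yes _ | no ¬q = offBox (¬q ∘ proj₂)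

ext-outside : ∀ n g {a b} → ¬ (a < box n × b < box n) → ext n g a b ≡ nothing
ext-outside n g {a} {b} ¬ab with a <? box n | b <? box n
... | yes p | yes q = ⊥-elim (¬ab (p , q))
... | no _  | _     = refl
... | yes _ | no _  = refl

ext-Tiling : ∀ n g → T (isTiling n g) → Tiling n (ext n g)
ext-Tiling n g t = record { none = λ {a} {b} → none′ a b ; some = λ {a} {b} → some′ a b ; partner = partner′ }
  where
  ok : ∀ a b {x} → ext n g (toℕ a) (toℕ b) ≡ x → CellOK n g a b x
  ok a b eq = subst (CellOK n g a b) (trans (sym (ext-toℕ n g a b)) eq) (to (isTiling⇔ n g) t a b)
  none′ : ∀ a b → ext n g a b ≡ nothing → ¬ Square n a b
  none′ a b eq with range n a b
  ... | inBox a b   = ok a b eq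
  ... | offBox ¬ab  = ¬ab ∘ Square⇒box a b
  some′ : ∀ a b {d} → ext n g a b ≡ just d → Square n a b
  some′ a b eq with range n a b
  ... | inBox a b  = proj₁ (ok a b eq)
  ... | offBox ¬ab with trans (sym (ext-outside n g ¬ab)) eq
  ...   | ()
  partner′ : ∀ {a b d a′ b′} → ext n g a b ≡ just d → Adjacent d a b a′ b′ → ext n g a′ b′ ≡ just (opp d)
  partner′ {a} {b} {d} eq adj with range n a b
  ... | offBox ¬ab = ⊥-elim (¬ab (Square⇒box a b (some′ a b eq)))
  ... | inBox a b with ok a b eq
  ...   | _ , a′ , b′ , st , _ , eq′ with Adjacent-unique d (step⇒Adjacent d a b st) adj
  ...     | refl , refl = trans (ext-toℕ n g a′ b′) eq′

toℕ+opposite : ∀ n (a : Fin (box n)) → toℕ a + toℕ (opposite a) ≡ suc (dbl n)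
toℕ+opposite n a = suc-injective (trans (cong (suc (toℕ a) +_) (opposite-prop a)) (m+[n∸m]≡n (toℕ<n a)))

ext-Symmetric : ∀ n g → T (isTInvariant n g) → Symmetric n (ext n g)
ext-Symmetric n g t {a} {a′} b eq with range n a b
... | inBox a b =
  trans (cong (λ x → ext n g x (toℕ b)) (+-cancelˡ-≡ (toℕ a) _ _ (trans eq (sym (toℕ+opposite n a)))))
  (trans (ext-toℕ n g (opposite a) b)
  (trans (to (isTInvariant⇔ n g) t a b)
         (cong (mapMaybe reflDir) (sym (ext-toℕ n g a b)))))
-- The equation for `a` and `a′` keeps `a` in the box, so it is `b` that is off it, and the mirror
-- square is off it too.
... | offBox ¬ab =
  trans (ext-outside n g {a′} {b} (λ (_ , q) → ¬ab (a<box , q)))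
        (cong (mapMaybe reflDir) (sym (ext-outside n g ¬ab)))
  where
  a<box : a < box n
  a<box = s≤s (m+n≤o⇒m≤o a (≤-reflexive eq))

grid : ∀ n → (ℕ → ℕ → Maybe Dir) → Grid n
grid n G = tabulate λ a → tabulate λ b → G (toℕ a) (toℕ b)

at-grid : ∀ n G a b → at {n} (grid n G) a b ≡ G (toℕ a) (toℕ b)
at-grid n G a b =
  trans (cong (λ v → lookup v b) (lookup∘tabulate (λ a → tabulate λ b → G (toℕ a) (toℕ b)) a))
        (lookup∘tabulate (λ b → G (toℕ a) (toℕ b)) b)

grid-unique : ∀ n G g → (∀ a b → G (toℕ a) (toℕ b) ≡ at {n} g a b) → grid n G ≡ g
grid-unique n G g eq =
  trans (tabulate-cong (λ a → trans (tabulate-cong (eq a)) (tabulate∘lookup (lookup g a))))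
        (tabulate∘lookup g)

grid-isTiling : ∀ n {G} → Tiling n G → T (isTiling n (grid n G))
grid-isTiling n {G} H = from (isTiling⇔ n (grid n G)) ok
  where
  ok′ : ∀ a b x → G (toℕ a) (toℕ b) ≡ x → CellOK n (grid n G) a b x
  ok′ a b nothing  eq = none H eq
  ok′ a b (just d) eq with neighbour d (toℕ a) (toℕ b) (some H eq)
  -- The partner is first found among the natural numbers; being a tiled square, it then lies in the
  -- box.
  ... | a₁ , b₁ , adj with partner H eq adj | range n a₁ b₁
  ...   | eq′ | inBox a′ b′ = some H eq , a′ , b′ , Adjacent⇒step d a b adj , some H eq′
                             , trans (at-grid n G a′ b′) eq′
  ...   | eq′ | offBox ¬ab  = ⊥-elim (¬ab (Square⇒box a₁ b₁ (some H eq′)))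
  ok : ∀ a b → CellOK n (grid n G) a b (at {n} (grid n G) a b)
  ok a b = ok′ a b _ (sym (at-grid n G a b))

grid-isTInvariant : ∀ n {G} → Symmetric n G → T (isTInvariant n (grid n G))
grid-isTInvariant n {G} S = from (isTInvariant⇔ n (grid n G)) λ a b →
  trans (at-grid n G (opposite a) b)
  (trans (S (toℕ b) (toℕ+opposite n a)) (cong (mapMaybe reflDir) (sym (at-grid n G a b))))

ext-grid : ∀ n {G} → Tiling n G → ∀ a b → ext n (grid n G) a b ≡ G a b
ext-grid n {G} H a b with range n a b
... | inBox a b  = trans (ext-toℕ n (grid n G) a b) (at-grid n G a b)
... | offBox ¬ab = trans (ext-outside n (grid n G) ¬ab)
                          (sym (nothing-unless (some H) (¬ab ∘ Square⇒box a b)))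

-- Folding along the axis

-- Box index n + 1 is the column just right of the axis, and box row 0 lies below AD(n).
half : ℕ → (ℕ → ℕ → Maybe Dir) → ℕ → ℕ → Maybe Dir
half n G i b = G (i + suc n) (suc b)

isRight≡isLeft : ∀ {x y} → (x ≡ just right → y ≡ just left) → (y ≡ just left → x ≡ just right) →
                 isRight x ≡ isLeft y
isRight≡isLeft f g = ⇔→≡ {z = true} (mk⇔ (cong isLeft ∘ f ∘ isRight⇒) (cong isRight ∘ g ∘ isLeft⇒))

half-HalfTiling : ∀ {n G} → Tiling n G → HalfTiling n (half n G)
half-HalfTiling {n} {G} H = record
  { none = λ {i} {b} eq → none H eq ∘ from (Square⇔Region (rightOf i refl) b)
  ; some = λ {i} {b} eq → to (Square⇔Region (rightOf i refl) b) (some H eq)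
  ; up⇒down = λ eq → partner H eq (refl , refl)
  ; down⇒up = λ eq → partner H eq (refl , refl)
  -- Row 0 of the half is box row 1, so the partner would fall into box row 0, which contains no
  -- square.
  ; down₀ = λ {i} eq → ¬Square-row₀ {n} {i + suc n} (some H (partner H eq (refl , refl)))
  ; across = λ i b → isRight≡isLeft 
      (λ eq → partner H eq (refl , refl)) (λ eq → partner H eq (refl , refl))
  }

place : ∀ {n a} → (ℕ → ℕ → Maybe Dir) → Side n a → ℕ → Maybe Dir
place f (rightOf i _) b = f i b
place f (leftOf  i _) b = mapMaybe reflDir (f i b)

unfold : ℕ → (ℕ → ℕ → Maybe Dir) → ℕ → ℕ → Maybe Dir
unfold n f a zero    = nothing
unfold n f a (suc b) = place f (side n a) b

-- Lets `unfold` be evaluated with whichever description of a column is at hand, not only the one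
-- that `side` computes.
place-unique : ∀ {n a} f (s s′ : Side n a) b → place f s b ≡ place f s′ b
place-unique {n} f (rightOf i p) (rightOf i′ p′) b =
  cong (λ i → f i b) (+-cancelʳ-≡ (suc n) i i′ (trans p (sym p′)))
place-unique {a = a} f (leftOf i p) (leftOf i′ p′) b =
  cong (λ i → mapMaybe reflDir (f i b)) (+-cancelˡ-≡ a i i′ (trans p (sym p′)))
place-unique {n} f (rightOf i refl) (leftOf i′ p′) b =
  ⊥-elim (1+n≰n (≤-trans (m≤n+m (suc n) i) (m+n≤o⇒m≤o (i + suc n) (≤-reflexive p′))))
place-unique {n} f (leftOf i p) (rightOf i′ refl) b =
  ⊥-elim (1+n≰n (≤-trans (m≤n+m (suc n) i′) (m+n≤o⇒m≤o (i′ + suc n) (≤-reflexive p))))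

unfold-at : ∀ {n a} f (s : Side n a) b → unfold n f a (suc b) ≡ place f s b
unfold-at {n} {a} f = place-unique f (side n a)

reflDir-just : ∀ x {d} → mapMaybe reflDir x ≡ just d → x ≡ just (reflDir d)
reflDir-just (just up)    refl = refl
reflDir-just (just down)  refl = refl
reflDir-just (just left)  refl = refl
reflDir-just (just right) refl = refl

reflDir-nothing : ∀ x → mapMaybe reflDir x ≡ nothing → x ≡ nothing
reflDir-nothing nothing _ = refl

reflDir-involutive : ∀ x → mapMaybe reflDir (mapMaybe reflDir x) ≡ x
reflDir-involutive nothing      = refl
reflDir-involutive (just up)    = refl
reflDir-involutive (just down)  = refl
reflDir-involutive (just left)  = refl
reflDir-involutive (just right) = refl

right⇒left : ∀ {n f i b} → HalfTiling n f → f i b ≡ just right → f (suc i) b ≡ just left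
right⇒left {i = i} {b} H eq = isLeft⇒ (trans (sym (across H i b)) (cong isRight eq))

left⇒right : ∀ {n f i b} → HalfTiling n f → f (suc i) b ≡ just left → f i b ≡ just right
left⇒right {i = i} {b} H eq = isRight⇒ (trans (across H i b) (cong isLeft eq))

unfold-Tiling : ∀ {n f} → HalfTiling n f → Tiling n (unfold n f)
unfold-Tiling {n} {f} H = record
  { none = λ {a} {b} → none′ a b ; some = λ {a} {b} → some′ a b ; partner = λ {a} {b} {d} → partner′ a b d }
  where
  none′ : ∀ a b → unfold n f a b ≡ nothing → ¬ Square n a b
  none′ a zero    eq s = ¬Square-row₀ {n} {a} s
  none′ a (suc b) eq s with side n a
  ... | S@(rightOf i _) = none H eq (to (Square⇔Region S b) s)
  ... | S@(leftOf  i _) = none H (reflDir-nothing (f i b) eq) (to (Square⇔Region S b) s)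
  some′ : ∀ a b {d} → unfold n f a b ≡ just d → Square n a b
  some′ a (suc b) eq with side n a
  ... | S@(rightOf i _) = from (Square⇔Region S b) (some H eq)
  ... | S@(leftOf  i _) = from (Square⇔Region S b) (some H (reflDir-just (f i b) eq))
  at-side : ∀ {a x} (s : Side n a) b → place f s b ≡ x → unfold n f a (suc b) ≡ x
  at-side s b eq = trans (unfold-at f s b) eq
  at-left : ∀ {a x} i b → a + i ≡ n → f i b ≡ x → unfold n f a (suc b) ≡ mapMaybe reflDir x
  at-left i b p eq = at-side (leftOf i p) b (cong (mapMaybe reflDir) eq)
  at-right : ∀ {a x} i b → i + suc n ≡ a → f i b ≡ x → unfold n f a (suc b) ≡ x
  at-right i b p eq = at-side (rightOf i p) b eq
  partner′ : ∀ a b d {a′ b′} → unfold n f a b ≡ just d → Adjacent d a b a′ b′ →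
             unfold n f a′ b′ ≡ just (opp d)
  partner′ a (suc b) up eq (refl , refl) with side n a
  ... | rightOf i p = up⇒down H eq
  ... | leftOf  i p = cong (mapMaybe reflDir) (up⇒down H (reflDir-just (f i b) eq))
  partner′ a (suc zero) down eq (refl , refl) with side n a
  ... | rightOf i p = ⊥-elim (down₀ H eq)
  ... | leftOf  i p = ⊥-elim (down₀ H (reflDir-just (f i 0) eq))
  partner′ a (suc (suc b)) down eq (refl , refl) with side n a
  ... | rightOf i p = down⇒up H eq
  ... | leftOf  i p = cong (mapMaybe reflDir) (down⇒up H (reflDir-just (f i (suc b)) eq))
  partner′ a (suc b) right eq (refl , refl) with side n a
  ... | rightOf i p = at-right (suc i) b (cong suc p) (right⇒left H eq)
  -- The domino crosses the axis: its partner is its own mirror image, whose entry is the `left` in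
  -- column 0.
  ... | leftOf zero p = at-right 0 b (cong suc (trans (sym p) (+-identityʳ a))) (reflDir-just (f 0 b) eq)
  ... | leftOf (suc i) p = at-left i b (trans (sym (+-suc a i)) p) (left⇒right H (reflDir-just (f (suc i) b) eq))
  partner′ (suc a) (suc b) left eq (refl , refl) with side n (suc a)
  ... | rightOf zero p = at-left 0 b (trans (+-identityʳ a) (sym (suc-injective p))) eq
  ... | rightOf (suc i) p = at-right i b (suc-injective p) (left⇒right H eq)
  ... | leftOf i p = at-left (suc i) b (trans (+-suc a i) p) (right⇒left H (reflDir-just (f i b) eq))

n+1+n : ∀ n → n + suc n ≡ suc (dbl n)
n+1+n n = trans (+-suc n n) (cong suc (sym (dbl≡+ n)))

unfold-Symmetric : ∀ n f → Symmetric n (unfold n f)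
unfold-Symmetric n f zero    eq = refl
unfold-Symmetric n f {a} {a′} (suc b) eq with side n a
... | rightOf i refl = unfold-at f (leftOf i a′+i≡n) b
  where
  a′+i≡n : a′ + i ≡ n
  a′+i≡n = +-cancelʳ-≡ (suc n) _ n (trans (+-assoc a′ i (suc n))
    (trans (+-comm a′ (i + suc n)) (trans eq (sym (n+1+n n)))))
... | leftOf i p = trans (unfold-at f (rightOf i i+1+n≡a′) b) (sym (reflDir-involutive (f i b)))
  where
  i+1+n≡a′ : i + suc n ≡ a′
  i+1+n≡a′ = +-cancelˡ-≡ a _ a′ (trans (sym (+-assoc a i (suc n)))
    (trans (cong (_+ suc n) p) (trans (n+1+n n) (sym eq))))

-- Invariance enters here: it recovers the left half from the right one.
unfold-half : ∀ n {G f} → Tiling n G → Symmetric n G → (∀ i b → f i b ≡ half n G i b) →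
              ∀ a b → unfold n f a b ≡ G a b
unfold-half n H S eq a zero = sym (nothing-unless (some H) (¬Square-row₀ {n} {a}))
unfold-half n H S eq a (suc b) with side n a
... | rightOf i refl = eq i b
... | leftOf i p = trans (cong (mapMaybe reflDir) (eq i b)) (sym (S (suc b)
  (trans (+-comm (i + suc n) a) (trans (sym (+-assoc a i (suc n))) (trans (cong (_+ suc n) p) (n+1+n n))))))

-- The proof component of an invariant tiling is a proposition, so one round trip reduces to
-- equality of grids; the other reduces to pointwise agreement by `chain-entries`.
Chain↔InvTiling : ∀ n → Σ (Bits (dbl n)) (Chain n) ↔ InvTiling n
Chain↔InvTiling n = mk↔ₛ′ fromChain toChain fromChain∘toChain toChain∘fromChain
  where
  invariant⇔ : ∀ g → T (isTiling n g ∧ isTInvariant n g) ⇔ (T (isTiling n g) × T (isTInvariant n g))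
  invariant⇔ g = T-∧
  fromChain : Σ (Bits (dbl n)) (Chain n) → InvTiling n
  fromChain (ε , ch) =
    grid n G , from (invariant⇔ (grid n G))
      ( grid-isTiling n {G} (unfold-Tiling (entries-HalfTiling n ch))
      , grid-isTInvariant n {G} (λ {a} {a′} → unfold-Symmetric n (entries n ch) {a} {a′}))
    where G = unfold n (entries n ch)
  halfTiling : ((g , t) : InvTiling n) → HalfTiling n (half n (ext n g))
  halfTiling (g , t) = half-HalfTiling (ext-Tiling n g (proj₁ (to (invariant⇔ g) t)))
  toChain : InvTiling n → Σ (Bits (dbl n)) (Chain n)
  toChain (g , t) = lefts n (half n (ext n g)) , chain n (halfTiling (g , t))
  InvTiling-≡ : (x y : InvTiling n) → proj₁ x ≡ proj₁ y → x ≡ y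
  InvTiling-≡ (g , t) (_ , u) refl = cong (g ,_) (T-irrelevant t u)
  fromChain∘toChain : ∀ x → fromChain (toChain x) ≡ x
  fromChain∘toChain (g , t) = InvTiling-≡ (fromChain (toChain (g , t))) (g , t)
    (grid-unique n (unfold n (entries n (chain n (halfTiling (g , t))))) g λ a b →
    trans (unfold-half n (ext-Tiling n g (proj₁ (to (invariant⇔ g) t)))
             (λ {a} {a′} → ext-Symmetric n g (proj₂ (to (invariant⇔ g) t)) {a} {a′})
             (entries-chain n (halfTiling (g , t))) (toℕ a) (toℕ b))
          (ext-toℕ n g a b))
  toChain∘fromChain : ∀ x → toChain (fromChain x) ≡ x
  toChain∘fromChain (ε , ch) = chain-entries n ch (halfTiling (fromChain (ε , ch))) λ i b →
    trans (ext-grid n (unfold-Tiling (entries-HalfTiling n ch)) (i + suc n) (suc b))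
          (unfold-at (entries n ch) (rightOf i refl) b)

theorem2 : (n : ℕ) → 1 ≤ n → Fin (normC n) ↔ InvTiling n
theorem2 (suc k) _ = ↔-trans (normC↔Chain k) (Chain↔InvTiling (suc k))
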